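{- Let $\Gamma=\Gamma'\cup_C\Gamma''$ be an induced $4$-cycle amalgam. If $\Gamma$ admits a legal system, then both $\Gamma'$ and $\Gamma''$ admit legal systems.
   Context: All graphs are finite, simple and undirected. A one-vertex graph is connected; the empty graph is not connected. $H[T]$ denotes the subgraph of $H$ induced on $T$. Induced $4$-cycle amalgam: let $\Gamma'$ and $\Gamma''$ be finite simple undirected graphs and let $C$ be a $4$-cycle. The graph $\Gamma=\Gamma'\cup_C\Gamma''$, with vertex set $V(\Gamma')\cup V(\Gamma'')$ and edge set $E(\Gamma')\cup E(\Gamma'')$, is called an induced $4$-cycle amalgam if (i) $V(\Gamma')\cap V(\Gamma'')=V(C)$ and $E(\Gamma')\cap E(\Gamma'')=E(C)$; (ii) the subgraph of $\Gamma$ induced by $V(C)$ is exactly $C$; (iii) no edge of $\Gamma$ joins $V(\Gamma')\setminus V(C)$ to $V(\Gamma'')\setminus V(C)$. Legal systems: subsets of $V(H)$ are identified with vectors in $\mathbb{F}_2^{V(H)}$ via characteristic vectors, so symmetric difference is vector addition. A move at a vertex $v$ of $H$ is a subset $m\subseteq V(H)$ such that $v\in m$ and $m$ contains no neighbour of $v$. A state $T\subseteq V(H)$ is legal if the induced subgraphs $H[T]$ and $H[V(H)\setminus T]$ are both nonempty and connected. A legal system for $H$ is a choice of a move $m_v$ at each vertex $v$ together with a state $S\subseteq V(H)$ such that every element of the coset $S+\operatorname{span}_{\mathbb{F}_2}\{m_v:v\in V(H)\}$ is a legal state. -}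

module Defs where

open import Data.Bool.Base using (_xor_)
open import Data.Fin.Base using (Fin)
open import Data.Fin.Subset
  using (Subset; _∈_; _⊆_; _∩_; _∪_; _─_; ⁅_⁆; Nonempty) renaming (⊥ to ∅)
open import Data.Fin.Subset.Properties using (_∈?_; x∈p∩q⁺; x∈p∪q⁺)
open import Data.List.Base using (List; []; _∷_)
import Data.List.Membership.Propositional as List
open import Data.List.Relation.Unary.Unique.Propositional using (Unique)
open import Data.Nat.Base using (ℕ)
open import Data.Product.Base using (_×_; _,_; proj₁; ∃-syntax)
open import Data.Sum.Base using (_⊎_; inj₁; inj₂) renaming (map to ⊎-map)
open import Data.Vec.Base using (zipWith)
open import Function.Bundles using (_⇔_)
open import Level using (0ℓ)
open import Relation.Binary.Construct.Closure.ReflexiveTransitive using (Star)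
open import Relation.Binary.Core using (Rel)
open import Relation.Binary.Definitions using (Decidable; Irreflexive; Symmetric)
open import Relation.Binary.PropositionalEquality.Core using (_≡_)
open import Relation.Nullary.Decidable.Core using (_×-dec_; _⊎-dec_)
open import Relation.Nullary.Negation.Core using (¬_)

private
  variable
    n : ℕ

-- A finite simple undirected graph whose vertices are drawn from the common
-- universe Fin n.  The vertex set need not be all of Fin n, so that different
-- graphs over the same universe can overlap and unions and intersections of
-- their vertex and edge sets make literal sense.
record Graph (n : ℕ) : Set₁ where
  field
    V      : Subset n
    Adj    : Rel (Fin n) 0ℓ
    adj?   : Decidable Adj
    sym    : Symmetric Adj
    irrefl : Irreflexive _≡_ Adj
    adj⇒∈V : ∀ {u v} → Adj u v → u ∈ V

open Graph public using (V; Adj)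

infix 4 _≋_
infixl 6 _∪ᴳ_
infix 8 _[_]

_≋_ : Graph n → Graph n → Set
G ≋ H = V G ≡ V H × (∀ u v → Adj G u v ⇔ Adj H u v)

_∪ᴳ_ : Graph n → Graph n → Graph n
G ∪ᴳ H = record
  { V      = V G ∪ V H
  ; Adj    = λ u v → Adj G u v ⊎ Adj H u v
  ; adj?   = λ u v → Graph.adj? G u v ⊎-dec Graph.adj? H u v
  ; sym    = ⊎-map (Graph.sym G) (Graph.sym H)
  ; irrefl = λ { eq (inj₁ e) → Graph.irrefl G eq e
               ; eq (inj₂ e) → Graph.irrefl H eq e }
  ; adj⇒∈V = λ e → x∈p∪q⁺ (⊎-map (Graph.adj⇒∈V G) (Graph.adj⇒∈V H) e)
  }

-- The induced subgraph; elements of T that are not vertices of H are ignored.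
_[_] : Graph n → Subset n → Graph n
H [ T ] = record
  { V      = V H ∩ T
  ; Adj    = λ u v → Adj H u v × u ∈ T × v ∈ T
  ; adj?   = λ u v → Graph.adj? H u v ×-dec ((u ∈? T) ×-dec (v ∈? T))
  ; sym    = λ (e , u∈T , v∈T) → Graph.sym H e , v∈T , u∈T
  ; irrefl = λ eq e → Graph.irrefl H eq (proj₁ e)
  ; adj⇒∈V = λ (e , u∈T , _) → x∈p∩q⁺ (Graph.adj⇒∈V H e , u∈T)
  }

-- Walks are elements of Star (Adj G).  The empty graph is not connected.
Connected : Graph n → Set
Connected G =
  Nonempty (V G) × (∀ {u v} → u ∈ V G → v ∈ V G → Star (Adj G) u v)

record IsFourCycle (C : Graph n) : Set where
  field
    a b c d  : Fin n
    distinct : Unique (a ∷ b ∷ c ∷ d ∷ [])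
    vertices : V C ≡ ⁅ a ⁆ ∪ ⁅ b ⁆ ∪ ⁅ c ⁆ ∪ ⁅ d ⁆

  sides : List (Fin n × Fin n)
  sides = (a , b) ∷ (b , c) ∷ (c , d) ∷ (d , a) ∷ []

  field
    edges : ∀ u v → Adj C u v ⇔ ((u , v) List.∈ sides ⊎ (v , u) List.∈ sides)

-- The amalgam itself is the graph G ∪ᴳ H.
record IsInducedFourCycleAmalgam (G H C : Graph n) : Set where
  field
    fourCycle  : IsFourCycle C
    V-meet     : V G ∩ V H ≡ V C
    E-meet     : ∀ u v → (Adj G u v × Adj H u v) ⇔ Adj C u v
    induced    : (G ∪ᴳ H) [ V C ] ≋ C
    noCrossing : ∀ {u v} → u ∈ V G ─ V C → v ∈ V H ─ V C → ¬ Adj (G ∪ᴳ H) u v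

infixl 6 _△_

-- Symmetric difference, i.e. addition of characteristic vectors over 𝔽₂.
_△_ : Subset n → Subset n → Subset n
_△_ = zipWith _xor_

-- The 𝔽₂-linear span of a set of vectors, as the smallest subspace containing
-- it; closure under scalars is automatic over 𝔽₂.
data Span (P : Subset n → Set) : Subset n → Set where
  gen  : ∀ {x} → P x → Span P x
  zero : Span P ∅
  add  : ∀ {x y} → Span P x → Span P y → Span P (x △ y)

IsMove : Graph n → Fin n → Subset n → Set
IsMove H v m = m ⊆ V H × v ∈ m × (∀ {u} → u ∈ m → ¬ Adj H v u)

IsLegalState : Graph n → Subset n → Set
IsLegalState H T =
  T ⊆ V H × Connected (H [ T ]) × Connected (H [ V H ─ T ])

-- Only the values of move at vertices of H are constrained or used.
record LegalSystem (H : Graph n) : Set where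
  field
    move   : Fin n → Subset n
    isMove : ∀ {v} → v ∈ V H → IsMove H v (move v)
    state  : Subset n
    legal  : ∀ {w} → Span (λ x → ∃[ v ] (v ∈ V H × x ≡ move v)) w →
             IsLegalState H (state △ w)

{-# OPTIONS --safe #-}

-- Restrict the moves and the state to Γ′.  A restricted state T ∩ V(Γ′) inherits
-- connectivity from T unless a walk of T makes an excursion through Γ″ between
-- opposite corners s, t of C while T contains no other corner; then one of
-- T + m_s, T + m_t, T + m_s + m_t avoids C but not V(Γ″) and so, being connected,
-- misses V(Γ′).  Hence restriction works unless some state T or its complement
-- misses V(Γ′).  In that case m_z = T + {z} for each vertex z of Γ′ outside C, as z
-- is isolated in T + m_z, and comparing with the moves at the corners shows that z
-- is adjacent to all of C.  Then the move {a,c} at a and c, the moves {v} elsewhere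
-- and the state {a} form a legal system for Γ′: every state contains exactly one of
-- a, c, and that corner is adjacent to all its other vertices.
module Submission where

open import Defs
open import Data.Bool.Base using (true; false; not; _xor_)
open import Data.Bool.Properties using (xor-assoc; ∧-distribʳ-xor)
open import Data.Empty using (⊥; ⊥-elim)
open import Data.Fin.Base using (Fin)
open import Data.Fin.Properties using (_≟_; all?; any?)
open import Data.Fin.Subset
  using (Subset; inside; outside; _∈_; _∉_; _⊆_; _∩_; _∪_; _─_; ⁅_⁆; Nonempty)
  renaming (⊥ to ∅)
open import Data.Fin.Subset.Properties
  using (_∈?_; nonempty?; ∉⊥; x∈⁅x⁆; x∈⁅y⁆⇒x≡y; x∈p∩q⁺; x∈p∩q⁻; x∈p∪q⁺; x∈p∪q⁻;
         x∈p∧x∉q⇒x∈p─q; p─q⊆p; p∩q⊆p; p∩q⊆q; ∩-comm; ∩-zeroˡ; ∪-comm; ⊆-antisym)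
import Data.List.Membership.Propositional as List
open import Data.List.Relation.Unary.All using ([]; _∷_)
open import Data.List.Relation.Unary.AllPairs using ([]; _∷_)
open import Data.List.Relation.Unary.Any using (here; there)
open import Data.Nat.Base using (ℕ)
open import Data.Product.Base using (_×_; _,_; proj₁; proj₂; ∃-syntax)
open import Data.Sum.Base using (_⊎_; inj₁; inj₂; swap)
open import Data.Vec.Base using ([]; _∷_; here; there; lookup)
open import Data.Vec.Properties
  using ([]=⇒lookup; lookup⇒[]=; lookup-zipWith; lookup-replicate;
         zipWith-assoc; zipWith-distribʳ)
open import Function.Base using (_∘_; id)
open import Function.Bundles using (mk⇔; module Equivalence)
open import Relation.Binary.Construct.Closure.ReflexiveTransitive
  using (Star; ε; _◅_; _◅◅_; gmap; reverse)
open import Relation.Binary.PropositionalEquality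
  using (_≡_; _≢_; refl; sym; trans; cong; cong₂; subst)
open import Relation.Nullary.Decidable
  using (Dec; yes; no; decidable-stable; _×-dec_; _→-dec_; ¬?)
open import Relation.Nullary.Negation using (¬_; contradiction)

open Equivalence using (to; from)

private
  variable
    n : ℕ
    x : Fin n
    p q r : Subset n

-- Symmetric difference of subsets

∈△⁺ˡ : x ∈ p → x ∉ q → x ∈ p △ q
∈△⁺ˡ {q = outside ∷ _} here        _   = here
∈△⁺ˡ {q = inside  ∷ _} here        x∉q = contradiction here x∉q
∈△⁺ˡ {q = _ ∷ _}       (there x∈p) x∉q = there (∈△⁺ˡ x∈p (x∉q ∘ there))

∈△⁺ʳ : x ∉ p → x ∈ q → x ∈ p △ q
∈△⁺ʳ {p = outside ∷ _} _   here        = here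
∈△⁺ʳ {p = inside  ∷ _} x∉p here        = contradiction here x∉p
∈△⁺ʳ {p = _ ∷ _}       x∉p (there x∈q) = there (∈△⁺ʳ (x∉p ∘ there) x∈q)

∉△⁺ : x ∈ p → x ∈ q → x ∉ p △ q
∉△⁺ {p = _ ∷ _} {q = _ ∷ _} here        here        ()
∉△⁺ {p = _ ∷ _} {q = _ ∷ _} (there x∈p) (there x∈q) (there x∈△) = ∉△⁺ x∈p x∈q x∈△

∈△⁻ : ∀ (p q : Subset n) → x ∈ p △ q → (x ∈ p × x ∉ q) ⊎ (x ∉ p × x ∈ q)
∈△⁻ {x = x} p q x∈△ with x ∈? p | x ∈? q
... | yes x∈p | yes x∈q = contradiction x∈△ (∉△⁺ x∈p x∈q)
... | yes x∈p | no  x∉q = inj₁ (x∈p , x∉q)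
... | no  x∉p | yes x∈q = inj₂ (x∉p , x∈q)
... | no  x∉p | no  x∉q = contradiction x∈△ (neither p q x∉p x∉q)
  where
  neither : ∀ {n} {x : Fin n} (p q : Subset n) → x ∉ p → x ∉ q → x ∉ p △ q
  neither (inside  ∷ _) (outside ∷ _) x∉p _   here      = x∉p here
  neither (outside ∷ _) (inside  ∷ _) _   x∉q here      = x∉q here
  neither (_ ∷ p)       (_ ∷ q)       x∉p x∉q (there h) =
    neither p q (x∉p ∘ there) (x∉q ∘ there) h

∉△⁻ : x ∉ p → x ∉ q → x ∉ p △ q
∉△⁻ {p = p} {q = q} x∉p x∉q x∈△ with ∈△⁻ p q x∈△
... | inj₁ (x∈p , _) = x∉p x∈p
... | inj₂ (_ , x∈q) = x∉q x∈q

∈△⇒∈ʳ : x ∉ p → x ∈ p △ q → x ∈ q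
∈△⇒∈ʳ {p = p} {q = q} x∉p x∈△ with ∈△⁻ p q x∈△
... | inj₁ (x∈p , _) = contradiction x∈p x∉p
... | inj₂ (_ , x∈q) = x∈q

△-⊆ : p ⊆ r → q ⊆ r → p △ q ⊆ r
△-⊆ {p = p} {q = q} p⊆r q⊆r x∈△ with ∈△⁻ p q x∈△
... | inj₁ (x∈p , _) = p⊆r x∈p
... | inj₂ (_ , x∈q) = q⊆r x∈q

△-assoc : ∀ (p q r : Subset n) → (p △ q) △ r ≡ p △ (q △ r)
△-assoc = zipWith-assoc xor-assoc

∩-distribʳ-△ : ∀ (r p q : Subset n) → (p △ q) ∩ r ≡ (p ∩ r) △ (q ∩ r)
∩-distribʳ-△ = zipWith-distribʳ ∧-distribʳ-xor

△-cancelˡ : ∀ (p q : Subset n) → p △ (p △ q) ≡ q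
△-cancelˡ []            []      = refl
△-cancelˡ (outside ∷ p) (y ∷ q) = cong (y ∷_) (△-cancelˡ p q)
△-cancelˡ (inside  ∷ p) (inside  ∷ q) = cong (_ ∷_) (△-cancelˡ p q)
△-cancelˡ (inside  ∷ p) (outside ∷ q) = cong (_ ∷_) (△-cancelˡ p q)

x∈p─q⇒x∉q : ∀ (p q : Subset n) → x ∈ p ─ q → x ∉ q
x∈p─q⇒x∉q (_ ∷ p) (inside  ∷ q) (there x∈─) (there x∈q) = x∈p─q⇒x∉q p q x∈─ x∈q
x∈p─q⇒x∉q (_ ∷ p) (outside ∷ q) (there x∈─) (there x∈q) = x∈p─q⇒x∉q p q x∈─ x∈q

-- For a state inside `V H` this turns complementation into addition of the vector `V H`, so
-- complements obey the same linear algebra as states.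
q⊆p⇒p△q≡p─q : ∀ {p q : Subset n} → q ⊆ p → p △ q ≡ p ─ q
q⊆p⇒p△q≡p─q {p = p} {q} q⊆p = ⊆-antisym ⇒ ⇐
  where
  ⇒ : p △ q ⊆ p ─ q
  ⇒ x∈△ with ∈△⁻ p q x∈△
  ... | inj₁ (x∈p , x∉q) = x∈p∧x∉q⇒x∈p─q x∈p x∉q
  ... | inj₂ (x∉p , x∈q) = contradiction (q⊆p x∈q) x∉p
  ⇐ : p ─ q ⊆ p △ q
  ⇐ x∈─ = ∈△⁺ˡ (p─q⊆p p q x∈─) (x∈p─q⇒x∉q p q x∈─)

x∉p⇒lookup≡false : ∀ (p : Subset n) → x ∉ p → lookup p x ≡ false
x∉p⇒lookup≡false {x = x} p x∉p with lookup p x in eq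
... | false = refl
... | true  = contradiction (lookup⇒[]= x p eq) x∉p

lookup-△ : ∀ (p q : Subset n) (x : Fin n) → lookup (p △ q) x ≡ lookup p x xor lookup q x
lookup-△ p q x = lookup-zipWith _xor_ x p q

-- States of a legal system and their complements

module States {H : Graph n} (L : LegalSystem H) where
  open LegalSystem L public

  Translation : Subset n → Set
  Translation = Span (λ x → ∃[ v ] (v ∈ V H × x ≡ move v))

  move⊆V : ∀ {v} → v ∈ V H → move v ⊆ V H
  move⊆V v∈V = proj₁ (isMove v∈V)

  v∈move : ∀ {v} → v ∈ V H → v ∈ move v
  v∈move v∈V = proj₁ (proj₂ (isMove v∈V))

  neighbour∉move : ∀ {u v} → v ∈ V H → Adj H v u → u ∉ move v
  neighbour∉move v∈V e u∈m = proj₂ (proj₂ (isMove v∈V)) u∈m e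

  -- Complements are included so that connectivity of a state and of its complement
  -- are instances of one statement.
  State : Subset n → Set
  State T = ∃[ w ] (Translation w × (T ≡ state △ w ⊎ T ≡ V H △ (state △ w)))

  coset-⊆V : ∀ {w} → Translation w → state △ w ⊆ V H
  coset-⊆V t = proj₁ (legal t)

  State-⊆V : ∀ {T} → State T → T ⊆ V H
  State-⊆V (w , t , inj₁ refl) = coset-⊆V t
  State-⊆V (w , t , inj₂ refl) = △-⊆ id (coset-⊆V t)

  State-connected : ∀ {T} → State T → Connected (H [ T ])
  State-connected (w , t , inj₁ refl) = proj₁ (proj₂ (legal t))
  State-connected (w , t , inj₂ refl) =
    subst (λ T → Connected (H [ T ])) (sym (q⊆p⇒p△q≡p─q (coset-⊆V t)))
      (proj₂ (proj₂ (legal t)))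

  State-walk : ∀ {T x y} → State T → x ∈ T → y ∈ T → Star (Adj (H [ T ])) x y
  State-walk S x∈T y∈T = proj₂ (State-connected S)
    (x∈p∩q⁺ (State-⊆V S x∈T , x∈T)) (x∈p∩q⁺ (State-⊆V S y∈T , y∈T))

  State-complement : ∀ {T} → State T → State (V H △ T)
  State-complement (w , t , inj₁ refl) = w , t , inj₂ refl
  State-complement (w , t , inj₂ refl) = w , t , inj₁ (△-cancelˡ (V H) (state △ w))

  State-△move : ∀ {T v} → v ∈ V H → State T → State (T △ move v)
  State-△move {v = v} v∈V (w , t , eq) =
    w △ move v , add t (gen (v , v∈V , refl)) , shift eq
    where
    shift : ∀ {T} → T ≡ state △ w ⊎ T ≡ V H △ (state △ w) →
            T △ move v ≡ state △ (w △ move v) ⊎ T △ move v ≡ V H △ (state △ (w △ move v))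
    shift (inj₁ refl) = inj₁ (△-assoc state w (move v))
    shift (inj₂ refl) = inj₂ (trans (△-assoc (V H) (state △ w) (move v))
                                    (cong (V H △_) (△-assoc state w (move v))))

  -- The first step of a nontrivial walk from `x` inside `T` would end at a neighbour of `x` in `T`.
  isolated⇒singleton : ∀ {T x y} → State T → x ∈ T → (∀ {u} → Adj H x u → u ∉ T) →
                       y ∈ T → y ≡ x
  isolated⇒singleton S x∈T isolated y∈T with State-walk S x∈T y∈T
  ... | ε                      = refl
  ... | (e , _ , u∈T) ◅ _ = contradiction u∈T (isolated e)

-- Exchanging the two factors

≋-swap : ∀ {K G H : Graph n} → K ≋ G ∪ᴳ H → K ≋ H ∪ᴳ G
≋-swap {G = G} {H} (V≡ , Adj⇔) =
  trans V≡ (∪-comm (V G) (V H)) ,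
  λ u v → mk⇔ (swap ∘ to (Adj⇔ u v)) (from (Adj⇔ u v) ∘ swap)

amalgam-swap : ∀ {G H C : Graph n} →
               IsInducedFourCycleAmalgam G H C → IsInducedFourCycleAmalgam H G C
amalgam-swap {G = G} {H} amalgam = record
  { fourCycle  = fourCycle
  ; V-meet     = trans (∩-comm (V H) (V G)) V-meet
  ; E-meet     = λ u v → mk⇔ (λ (h , g) → to (E-meet u v) (g , h))
                              (λ e → let g , h = from (E-meet u v) e in h , g)
  ; induced    = trans (cong (_∩ _) (∪-comm (V H) (V G))) (proj₁ induced) ,
                 λ u v → mk⇔ (λ (e , inC) → to (proj₂ induced u v) (swap e , inC))
                              (λ e → let e′ , inC = from (proj₂ induced u v) e in swap e′ , inC)
  ; noCrossing = λ u∈ v∈ e → noCrossing v∈ u∈ (swap (Graph.sym (H ∪ᴳ G) e))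
  }
  where open IsInducedFourCycleAmalgam amalgam

-- `Γ` is given only up to `≋`, so that the module applies to either factor with the same graph `Γ`
-- and the same legal system.
module Half {Γ Γ′ Γ″ C : Graph n} (amalgam : IsInducedFourCycleAmalgam Γ′ Γ″ C)
            (Γ≋ : Γ ≋ Γ′ ∪ᴳ Γ″) where

  open IsInducedFourCycleAmalgam amalgam
  open IsFourCycle fourCycle

  -- Edges of the amalgam and corners of the cycle

  V′⊆V : V Γ′ ⊆ V Γ
  V′⊆V x∈ = subst (_ ∈_) (sym (proj₁ Γ≋)) (x∈p∪q⁺ (inj₁ x∈))

  V″⊆V : V Γ″ ⊆ V Γ
  V″⊆V x∈ = subst (_ ∈_) (sym (proj₁ Γ≋)) (x∈p∪q⁺ (inj₂ x∈))

  Adj′⇒Adj : ∀ {u v} → Adj Γ′ u v → Adj Γ u v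
  Adj′⇒Adj e = from (proj₂ Γ≋ _ _) (inj₁ e)

  split : ∀ {u v} → Adj Γ u v → Adj Γ′ u v ⊎ Adj Γ″ u v
  split = to (proj₂ Γ≋ _ _)

  ∈V : ∀ (H : Graph n) {u v} → Adj H u v → u ∈ V H × v ∈ V H
  ∈V H e = Graph.adj⇒∈V H e , Graph.adj⇒∈V H (Graph.sym H e)

  Corner : Fin n → Set
  Corner x = x ∈ V Γ′ × x ∈ V Γ″

  corner⇒∈C : ∀ {x} → Corner x → x ∈ V C
  corner⇒∈C = subst (_ ∈_) V-meet ∘ x∈p∩q⁺

  corner-edge⇒C : ∀ {u v} → Corner u → Corner v → Adj Γ′ u v ⊎ Adj Γ″ u v → Adj C u v
  corner-edge⇒C cu cv e = to (proj₂ induced _ _) (e , corner⇒∈C cu , corner⇒∈C cv)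

  -- Since `V C` induces exactly `C`, the edge belongs to `C`, and every edge of `C` lies in both
  -- factors.
  corner-edge : ∀ {u v} → Corner u → Corner v → Adj Γ u v → Adj Γ′ u v
  corner-edge cu cv e = proj₁ (from (E-meet _ _) (corner-edge⇒C cu cv (split e)))

  edge-at-interior : ∀ {u v} → u ∉ V Γ″ → Adj Γ u v → Adj Γ′ u v
  edge-at-interior u∉ e with split e
  ... | inj₁ e′ = e′
  ... | inj₂ e″ = contradiction (proj₁ (∈V Γ″ e″)) u∉

  edge-at-exterior : ∀ {u v} → u ∉ V Γ′ → Adj Γ u v → Adj Γ″ u v
  edge-at-exterior u∉ e with split e
  ... | inj₁ e′ = contradiction (proj₁ (∈V Γ′ e′)) u∉
  ... | inj₂ e″ = e″

  data IsCorner : Fin n → Set where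
    isA : IsCorner a
    isB : IsCorner b
    isC : IsCorner c
    isD : IsCorner d

  corner-view : ∀ {x} → Corner x → IsCorner x
  corner-view cx = view (subst (_ ∈_) vertices (corner⇒∈C cx))
    where
    view : ∀ {x} → x ∈ ⁅ a ⁆ ∪ ⁅ b ⁆ ∪ ⁅ c ⁆ ∪ ⁅ d ⁆ → IsCorner x
    view x∈ with x∈p∪q⁻ ⁅ a ⁆ (⁅ b ⁆ ∪ ⁅ c ⁆ ∪ ⁅ d ⁆) x∈
    ... | inj₁ x∈a with refl ← x∈⁅y⁆⇒x≡y a x∈a = isA
    ... | inj₂ x∈bcd with x∈p∪q⁻ ⁅ b ⁆ (⁅ c ⁆ ∪ ⁅ d ⁆) x∈bcd
    ...   | inj₁ x∈b with refl ← x∈⁅y⁆⇒x≡y b x∈b = isB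
    ...   | inj₂ x∈cd with x∈p∪q⁻ ⁅ c ⁆ ⁅ d ⁆ x∈cd
    ...     | inj₁ x∈c with refl ← x∈⁅y⁆⇒x≡y c x∈c = isC
    ...     | inj₂ x∈d with refl ← x∈⁅y⁆⇒x≡y d x∈d = isD

  C-edge⇒Adj′ : ∀ {u v} → (u , v) List.∈ sides → Adj Γ′ u v
  C-edge⇒Adj′ uv = proj₁ (from (E-meet _ _) (from (edges _ _) (inj₁ uv)))

  ab : Adj Γ′ a b
  ab = C-edge⇒Adj′ (here refl)
  bc : Adj Γ′ b c
  bc = C-edge⇒Adj′ (there (here refl))
  cd : Adj Γ′ c d
  cd = C-edge⇒Adj′ (there (there (here refl)))
  da : Adj Γ′ d a
  da = C-edge⇒Adj′ (there (there (there (here refl))))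

  sym′ : ∀ {u v} → Adj Γ′ u v → Adj Γ′ v u
  sym′ = Graph.sym Γ′

  corner : ∀ {x} → IsCorner x → Corner x
  corner x = x∈p∩q⁻ _ _ (subst (_ ∈_) (sym V-meet) (∈C x))
    where
    ∈C : ∀ {x} → IsCorner x → x ∈ V C
    ∈C isA = proj₁ (∈V C (from (edges _ _) (inj₁ (here refl))))
    ∈C isB = proj₂ (∈V C (from (edges _ _) (inj₁ (here refl))))
    ∈C isC = proj₁ (∈V C (from (edges _ _) (inj₁ (there (there (here refl))))))
    ∈C isD = proj₂ (∈V C (from (edges _ _) (inj₁ (there (there (here refl))))))

  -- Phrased as an exhaustion of the corners, so that a case analysis directly yields the two common
  -- neighbours of a diagonal pair.
  Opposite : Fin n → Fin n → Set
  Opposite s t = ∀ {x} → Corner x → x ≡ s ⊎ x ≡ t ⊎ (Adj Γ′ s x × Adj Γ′ t x)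

  opposite-sym : ∀ {s t} → Opposite s t → Opposite t s
  opposite-sym opp cx with opp cx
  ... | inj₁ x≡s              = inj₂ (inj₁ x≡s)
  ... | inj₂ (inj₁ x≡t)       = inj₁ x≡t
  ... | inj₂ (inj₂ (sx , tx)) = inj₂ (inj₂ (tx , sx))

  opposite-ac : Opposite a c
  opposite-ac cx with corner-view cx
  ... | isA = inj₁ refl
  ... | isB = inj₂ (inj₂ (ab , sym′ bc))
  ... | isC = inj₂ (inj₁ refl)
  ... | isD = inj₂ (inj₂ (sym′ da , cd))

  opposite-bd : Opposite b d
  opposite-bd cx with corner-view cx
  ... | isA = inj₂ (inj₂ (sym′ ab , da))
  ... | isB = inj₁ refl
  ... | isC = inj₂ (inj₂ (bc , sym′ cd))
  ... | isD = inj₂ (inj₁ refl)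

  compareCorners : ∀ {s t} → IsCorner s → IsCorner t → s ≡ t ⊎ Adj Γ′ s t ⊎ Opposite s t
  compareCorners isA isA = inj₁ refl
  compareCorners isA isB = inj₂ (inj₁ ab)
  compareCorners isA isC = inj₂ (inj₂ opposite-ac)
  compareCorners isA isD = inj₂ (inj₁ (sym′ da))
  compareCorners isB isA = inj₂ (inj₁ (sym′ ab))
  compareCorners isB isB = inj₁ refl
  compareCorners isB isC = inj₂ (inj₁ bc)
  compareCorners isB isD = inj₂ (inj₂ opposite-bd)
  compareCorners isC isA = inj₂ (inj₂ (opposite-sym opposite-ac))
  compareCorners isC isB = inj₂ (inj₁ (sym′ bc))
  compareCorners isC isC = inj₁ refl
  compareCorners isC isD = inj₂ (inj₁ cd)
  compareCorners isD isA = inj₂ (inj₁ da)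
  compareCorners isD isB = inj₂ (inj₂ (opposite-sym opposite-bd))
  compareCorners isD isC = inj₂ (inj₁ (sym′ cd))
  compareCorners isD isD = inj₁ refl

  -- The case of a cone over the cycle

  Coned : Set
  Coned = ∀ z → z ∈ V Γ′ → z ∉ V Γ″ → ∀ v → Corner v → Adj Γ′ z v

  -- Deciding this condition spares deciding whether some state misses `V Γ′`: its failure rules out
  -- such states by `missing-state⇒coned`, and its truth gives a legal system directly.
  coned? : Dec Coned
  coned? = all? λ z → (z ∈? V Γ′) →-dec (¬? (z ∈? V Γ″) →-dec
    all? λ v → ((v ∈? V Γ′) ×-dec (v ∈? V Γ″)) →-dec Graph.adj? Γ′ z v)

  module ConedCase (coned : Coned) where

    -- Inducedness would make the diagonal a side of `C`, and matching it with any of the eight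
    -- oriented sides identifies two distinct corners.
    a≁c : ¬ Adj Γ′ a c
    a≁c e with distinct | to (edges a c) (corner-edge⇒C (corner isA) (corner isC) (inj₁ e))
    ... | (a≢b ∷ a≢c ∷ a≢d ∷ []) ∷ (b≢c ∷ b≢d ∷ []) ∷ (c≢d ∷ []) ∷ [] ∷ [] | side = absurd side
      where
      absurd : ((a , c) List.∈ sides ⊎ (c , a) List.∈ sides) → ⊥
      absurd (inj₁ (here eq))                         = b≢c (sym (cong proj₂ eq))
      absurd (inj₁ (there (here eq)))                 = a≢b (cong proj₁ eq)
      absurd (inj₁ (there (there (here eq))))         = a≢c (cong proj₁ eq)
      absurd (inj₁ (there (there (there (here eq))))) = a≢d (cong proj₁ eq)
      absurd (inj₂ (here eq))                         = a≢c (sym (cong proj₁ eq))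
      absurd (inj₂ (there (here eq)))                 = b≢c (sym (cong proj₁ eq))
      absurd (inj₂ (there (there (here eq))))         = a≢d (cong proj₂ eq)
      absurd (inj₂ (there (there (there (here eq))))) = c≢d (cong proj₁ eq)

    hub⇒connected : ∀ {A h} → h ∈ V Γ′ → h ∈ A →
                    (∀ {x} → x ∈ V Γ′ → x ∈ A → x ≡ h ⊎ Adj Γ′ h x) → Connected (Γ′ [ A ])
    hub⇒connected {A} {h} h∈V h∈A spokes =
      (h , x∈p∩q⁺ (h∈V , h∈A)) ,
      λ x∈ y∈ → reverse (Graph.sym (Γ′ [ A ])) (fromHub x∈) ◅◅ fromHub y∈
      where
      fromHub : ∀ {x} → x ∈ V Γ′ ∩ A → Star (Adj (Γ′ [ A ])) h x
      fromHub x∈ with x∈p∩q⁻ (V Γ′) A x∈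
      ... | x∈V , x∈A with spokes x∈V x∈A
      ...   | inj₁ refl = ε
      ...   | inj₂ hx   = (hx , h∈A , x∈A) ◅ ε

    -- `h` dominates `A`: vertices off the cycle are adjacent to every corner by `coned`, two
    -- corners are neighbours of `h` by opposition, and `o` is excluded.
    corner-hub : ∀ {A h o} → Corner h → Opposite h o → h ∈ A → o ∉ A → Connected (Γ′ [ A ])
    corner-hub {A} {h} {o} ch opp h∈A o∉A = hub⇒connected (proj₁ ch) h∈A spokes
      where
      spokes : ∀ {x} → x ∈ V Γ′ → x ∈ A → x ≡ h ⊎ Adj Γ′ h x
      spokes {x} x∈V x∈A with x ∈? V Γ″
      ... | no x∉V″ = inj₂ (sym′ (coned x x∈V x∉V″ h ch))
      ... | yes x∈V″ with opp (x∈V , x∈V″)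
      ...   | inj₁ x≡h             = inj₁ x≡h
      ...   | inj₂ (inj₁ refl)     = contradiction x∈A o∉A
      ...   | inj₂ (inj₂ (hx , _)) = inj₂ hx

    -- The equation says that exactly one of `a` and `c` lies in `A`, and that one serves as hub.
    splits⇒connected : ∀ A → lookup A a ≡ not (lookup A c) → Connected (Γ′ [ A ])
    splits⇒connected A a≡¬c with a ∈? A | c ∈? A
    ... | yes a∈A | no  c∉A = corner-hub (corner isA) opposite-ac a∈A c∉A
    ... | no  a∉A | yes c∈A = corner-hub (corner isC) (opposite-sym opposite-ac) c∈A a∉A
    ... | yes a∈A | yes c∈A =
      contradiction (trans (sym ([]=⇒lookup a∈A)) (trans a≡¬c (cong not ([]=⇒lookup c∈A)))) λ ()
    ... | no  a∉A | no  c∉A =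
      contradiction (trans (sym (x∉p⇒lookup≡false A a∉A))
        (trans a≡¬c (cong not (x∉p⇒lookup≡false A c∉A)))) λ ()

    ac : Subset n
    ac = ⁅ a ⁆ ∪ ⁅ c ⁆

    ac⁻ : ∀ {x} → x ∈ ac → x ≡ a ⊎ x ≡ c
    ac⁻ x∈ with x∈p∪q⁻ ⁅ a ⁆ ⁅ c ⁆ x∈
    ... | inj₁ x∈a = inj₁ (x∈⁅y⁆⇒x≡y a x∈a)
    ... | inj₂ x∈c = inj₂ (x∈⁅y⁆⇒x≡y c x∈c)

    a∈ac : a ∈ ac
    a∈ac = x∈p∪q⁺ (inj₁ (x∈⁅x⁆ a))

    c∈ac : c ∈ ac
    c∈ac = x∈p∪q⁺ (inj₂ (x∈⁅x⁆ c))

    coneMove : Fin n → Subset n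
    coneMove v with v ∈? ac
    ... | yes _ = ac
    ... | no  _ = ⁅ v ⁆

    coneMove-isMove : ∀ {v} → v ∈ V Γ′ → IsMove Γ′ v (coneMove v)
    coneMove-isMove {v} v∈V with v ∈? ac
    ... | no _ = (λ x∈ → subst (_∈ V Γ′) (sym (x∈⁅y⁆⇒x≡y v x∈)) v∈V) , x∈⁅x⁆ v ,
                 λ x∈ e → Graph.irrefl Γ′ (sym (x∈⁅y⁆⇒x≡y v x∈)) e
    ... | yes v∈ac = ac⊆V , v∈ac , nonadjacent (ac⁻ v∈ac) ∘ ac⁻
      where
      ac⊆V : ac ⊆ V Γ′
      ac⊆V x∈ with ac⁻ x∈
      ... | inj₁ refl = proj₁ (corner isA)
      ... | inj₂ refl = proj₁ (corner isC)
      nonadjacent : ∀ {u v} → v ≡ a ⊎ v ≡ c → u ≡ a ⊎ u ≡ c → ¬ Adj Γ′ v u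
      nonadjacent (inj₁ refl) (inj₁ refl) = Graph.irrefl Γ′ refl
      nonadjacent (inj₁ refl) (inj₂ refl) = a≁c
      nonadjacent (inj₂ refl) (inj₁ refl) = a≁c ∘ sym′
      nonadjacent (inj₂ refl) (inj₂ refl) = Graph.irrefl Γ′ refl

    coneMove-balanced : ∀ v → lookup (coneMove v) a ≡ lookup (coneMove v) c
    coneMove-balanced v with v ∈? ac
    ... | yes _   = trans ([]=⇒lookup a∈ac) (sym ([]=⇒lookup c∈ac))
    ... | no v∉ac = trans (misses a∈ac) (sym (misses c∈ac))
      where
      misses : ∀ {x} → x ∈ ac → lookup ⁅ v ⁆ x ≡ false
      misses x∈ac = x∉p⇒lookup≡false ⁅ v ⁆
        λ x∈v → v∉ac (subst (_∈ ac) (x∈⁅y⁆⇒x≡y v x∈v) x∈ac)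

    Translation : Subset n → Set
    Translation = Span (λ x → ∃[ v ] (v ∈ V Γ′ × x ≡ coneMove v))

    -- Containing both or neither of `a` and `c` is a linear condition over 𝔽₂, so it passes from
    -- the moves to their span.
    balanced : ∀ {w} → Translation w → lookup w a ≡ lookup w c
    balanced (gen (v , _ , refl)) = coneMove-balanced v
    balanced zero = trans (lookup-replicate a outside) (sym (lookup-replicate c outside))
    balanced (add {x} {y} s t) = trans (lookup-△ x y a)
      (trans (cong₂ _xor_ (balanced s) (balanced t)) (sym (lookup-△ x y c)))

    translation⊆V : ∀ {w} → Translation w → w ⊆ V Γ′
    translation⊆V (gen (v , v∈V , refl)) = proj₁ (coneMove-isMove v∈V)
    translation⊆V zero                   = λ x∈∅ → contradiction x∈∅ ∉⊥
    translation⊆V (add s t)              = △-⊆ (translation⊆V s) (translation⊆V t)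

    coneSystem : LegalSystem Γ′
    coneSystem = record
      { move   = coneMove
      ; isMove = coneMove-isMove
      ; state  = ⁅ a ⁆
      ; legal  = coneLegal
      }
      where
      a∈V : a ∈ V Γ′
      a∈V = proj₁ (corner isA)
      c∈V : c ∈ V Γ′
      c∈V = proj₁ (corner isC)
      c∉a : c ∉ ⁅ a ⁆
      c∉a c∈ with distinct
      ... | (_ ∷ a≢c ∷ _) ∷ _ = a≢c (sym (x∈⁅y⁆⇒x≡y a c∈))
      coneLegal : ∀ {w} → Translation w → IsLegalState Γ′ (⁅ a ⁆ △ w)
      coneLegal {w} t = T⊆V , splits⇒connected T T-splits , splits⇒connected (V Γ′ ─ T) co-splits
        where
        T : Subset n
        T = ⁅ a ⁆ △ w
        T⊆V : T ⊆ V Γ′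
        T⊆V = △-⊆ (λ x∈ → subst (_∈ V Γ′) (sym (x∈⁅y⁆⇒x≡y a x∈)) a∈V) (translation⊆V t)
        T-splits : lookup T a ≡ not (lookup T c)
        -- `⁅ a ⁆` contains `a` but not `c`, and adding the balanced `w` flips both bits or neither.
        T-splits
          rewrite lookup-△ ⁅ a ⁆ w a | lookup-△ ⁅ a ⁆ w c
                | []=⇒lookup (x∈⁅x⁆ a) | x∉p⇒lookup≡false ⁅ a ⁆ c∉a | balanced t = refl
        co-splits : lookup (V Γ′ ─ T) a ≡ not (lookup (V Γ′ ─ T) c)
        -- `V Γ′` contains `a` and `c`, so complementation flips both bits.
        co-splits
          rewrite sym (q⊆p⇒p△q≡p─q T⊆V) | lookup-△ (V Γ′) T a | lookup-△ (V Γ′) T c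
                | []=⇒lookup a∈V | []=⇒lookup c∈V = cong not T-splits

  -- States disjoint from `V Γ′`

  module Restriction (L : LegalSystem Γ) where
    open States L

    Misses : Subset n → Set
    Misses T = ∀ {x} → x ∈ V Γ′ → x ∉ T

    -- If `z` and `v` were not adjacent, `v` would be isolated in `{z} + m_v`, which would then be
    -- `{v}`; both possibilities for `z` in `m_v` contradict this.
    missing-state⇒coned : ∀ {T} → State T → Misses T → Coned
    missing-state⇒coned {T} S misses z z∈V′ z∉V″ v (v∈V′ , v∈V″) =
      decidable-stable (Graph.adj? Γ′ z v) λ z≁v → absurd (z≁v ∘ edge-at-interior z∉V″)
      where
      z∈V : z ∈ V Γ
      z∈V = V′⊆V z∈V′
      v∈V : v ∈ V Γ
      v∈V = V′⊆V v∈V′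
      v≢z : v ≢ z
      v≢z refl = z∉V″ v∈V″

      neighbour∉T : ∀ {u} → Adj Γ z u → u ∉ T
      neighbour∉T e = misses (proj₂ (∈V Γ′ (edge-at-interior z∉V″ e)))

      T△mz : Subset n
      T△mz = T △ move z
      z∈T△mz : z ∈ T△mz
      z∈T△mz = ∈△⁺ʳ (misses z∈V′) (v∈move z∈V)
      T△mz≡z : ∀ {x} → x ∈ T△mz → x ≡ z
      T△mz≡z = isolated⇒singleton (State-△move z∈V S) z∈T△mz
        λ e → ∉△⁻ (neighbour∉T e) (neighbour∉move z∈V e)

      -- As T △ m_z = {z}, the state B is m_v with z toggled.
      B : Subset n
      B = T△mz △ move v
      S-B : State B
      S-B = State-△move v∈V (State-△move z∈V S)
      v∈B : v ∈ B
      v∈B = ∈△⁺ʳ (v≢z ∘ T△mz≡z) (v∈move v∈V)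

      B≡v : ¬ Adj Γ z v → ∀ {x} → x ∈ B → x ≡ v
      B≡v z≁v = isolated⇒singleton S-B v∈B λ e → ∉△⁻
        (λ u∈ → z≁v (Graph.sym Γ (subst (Adj Γ v) (T△mz≡z u∈) e))) (neighbour∉move v∈V e)

      absurd : ¬ Adj Γ z v → ⊥
      absurd z≁v with z ∈? move v
      -- If `m_v` avoids `z`, then `z` remains in `B`, whose only element is `v`.
      ... | no z∉mv = v≢z (sym (B≡v z≁v (∈△⁺ˡ z∈T△mz z∉mv)))
      -- Otherwise `B = {v}` leaves `m_v = {v, z}`, so the state `T + m_v` contains `v` along with
      -- the isolated vertex `z`.
      ... | yes z∈mv = v≢z (isolated⇒singleton (State-△move v∈V S)
          (∈△⁺ʳ (misses z∈V′) z∈mv) z-isolated (∈△⁺ʳ (misses v∈V′) (v∈move v∈V)))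
        where
        z-isolated : ∀ {u} → Adj Γ z u → u ∉ T △ move v
        z-isolated {u} e u∈ = z≁v (subst (Adj Γ z) (B≡v z≁v (∈△⁺ʳ u∉T△mz u∈mv)) e)
          where
          u∈mv : u ∈ move v
          u∈mv = ∈△⇒∈ʳ (neighbour∉T e) u∈
          u∉T△mz : u ∉ T△mz
          u∉T△mz u∈T△mz = Graph.irrefl Γ (sym (T△mz≡z u∈T△mz)) e

    -- Excursions outside `V Γ′` when no state misses it

    module NotMissing (notMissing : ∀ {T} → State T → ¬ Misses T) where

      -- Take the first step of the walk into `V Γ′`. An edge with an end outside `V Γ′` belongs to
      -- `Γ″`, so the vertex it reaches is a corner.
      entry : ∀ {A x y} → Star (Adj (Γ [ A ])) x y → x ∉ V Γ′ → y ∈ V Γ′ →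
              ∃[ u ] ∃[ e ] (u ∉ V Γ′ × u ∈ A × Corner e × e ∈ A × Adj Γ e u)
      entry ε x∉ y∈ = contradiction y∈ x∉
      entry {x = x} (_◅_ {j = z} (e , x∈A , z∈A) walk) x∉ y∈ with z ∈? V Γ′
      ... | no  z∉ = entry walk z∉ y∈
      ... | yes z∈ = x , z , x∉ , x∈A ,
                     (z∈ , proj₂ (∈V Γ″ (edge-at-exterior x∉ e))) , z∈A , Graph.sym Γ e

      -- By `entry`, a connected state with an exterior vertex but no corner cannot reach `V Γ′`, so
      -- it would miss that set.
      cornerless⇒no-exterior : ∀ {A x} → State A → (∀ {e} → Corner e → e ∉ A) →
                               x ∉ V Γ′ → x ∉ A
      cornerless⇒no-exterior S cornerless x∉ x∈A = notMissing S λ y∈ y∈A →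
        let _ , _ , _ , _ , ce , e∈A , _ = entry (State-walk S x∈A y∈A) x∉ y∈
        in cornerless ce e∈A

      module OppositePair {T s t} (S : State T) (cs : Corner s) (ct : Corner t)
                          (opp : Opposite s t) (s∈T : s ∈ T) (t∈T : t ∈ T)
                          (only : ∀ {x} → Corner x → x ∈ T → x ≡ s ⊎ x ≡ t) where

        s∈V : s ∈ V Γ
        s∈V = V′⊆V (proj₁ cs)

        -- `m_s` removes `s`. The two corners other than `s` and `t` are adjacent to both, hence
        -- outside `T` by `only`, and a move at `s` cannot add a neighbour of `s`.
        ∉T△ms : ∀ {e} → Corner e → e ≢ t → e ∉ T △ move s
        ∉T△ms ce e≢t with opp ce
        ... | inj₁ refl        = ∉△⁺ s∈T (v∈move s∈V)
        ... | inj₂ (inj₁ refl) = contradiction refl e≢t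
        ... | inj₂ (inj₂ (se , te)) = ∉△⁻ e∉T (neighbour∉move s∈V (Adj′⇒Adj se))
          where
          e∉T : _ ∉ T
          e∉T e∈T with only ce e∈T
          ... | inj₁ refl = Graph.irrefl Γ′ refl se
          ... | inj₂ refl = Graph.irrefl Γ′ refl te

        -- Otherwise `T + m_s` would have no corner, yet it keeps the exterior vertex `u`, a
        -- neighbour of `s`.
        exterior-neighbour⇒∉move : ∀ {u} → u ∉ V Γ′ → u ∈ T → Adj Γ s u → t ∉ move s
        exterior-neighbour⇒∉move u∉ u∈T su t∈ms =
          cornerless⇒no-exterior (State-△move s∈V S) cornerless u∉
            (∈△⁺ˡ u∈T (neighbour∉move s∈V su))
          where
          cornerless : ∀ {e} → Corner e → e ∉ T △ move s
          cornerless {e} ce with e ≟ t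
          ... | yes refl = ∉△⁺ t∈T t∈ms
          ... | no  e≢t  = ∉T△ms ce e≢t

      -- The exterior neighbours give `t ∉ m_s` and `s ∉ m_t`. Thus `t` is the only corner of
      -- `T + m_s`, and adding `m_t` removes it without bringing `s` back.
      no-exterior-detour : ∀ {T s t u v} → State T → Corner s → Corner t →
        Opposite s t → s ∈ T → t ∈ T → (∀ {x} → Corner x → x ∈ T → x ≡ s ⊎ x ≡ t) →
        u ∉ V Γ′ → u ∈ T → Adj Γ s u → v ∉ V Γ′ → v ∈ T → Adj Γ t v → ⊥
      no-exterior-detour {T} {s} {t} {u} S cs ct opp s∈T t∈T only u∉ u∈T su v∉ v∈T tv =
        -- The walk from `u` can enter `V Γ′` only at `t`; the exterior vertex `w` just before is a
        -- neighbour of `t`, so it survives the addition of `m_t`.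
        let w , e , w∉ , w∈A , ce , e∈A , ew = entry (State-walk S-A u∈A t∈A) u∉ (proj₁ ct)
            tw = subst (λ e → Adj Γ e w) (decidable-stable (e ≟ t) λ e≢t → ∉A ce e≢t e∈A) ew
        in cornerless⇒no-exterior (State-△move t∈V S-A) cornerless w∉
             (∈△⁺ˡ w∈A (neighbour∉move t∈V tw))
        where
        module st = OppositePair S cs ct opp s∈T t∈T only
        module ts = OppositePair S ct cs (opposite-sym opp) t∈T s∈T (λ cx → swap ∘ only cx)
        s∈V : s ∈ V Γ
        s∈V = V′⊆V (proj₁ cs)
        t∈V : t ∈ V Γ
        t∈V = V′⊆V (proj₁ ct)
        t∉ms : t ∉ move s
        t∉ms = st.exterior-neighbour⇒∉move u∉ u∈T su
        s∉mt : s ∉ move t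
        s∉mt = ts.exterior-neighbour⇒∉move v∉ v∈T tv
        A : Subset n
        A = T △ move s
        S-A : State A
        S-A = State-△move s∈V S
        ∉A : ∀ {e} → Corner e → e ≢ t → e ∉ A
        ∉A = st.∉T△ms
        u∈A : u ∈ A
        u∈A = ∈△⁺ˡ u∈T (neighbour∉move s∈V su)
        t∈A : t ∈ A
        t∈A = ∈△⁺ˡ t∈T t∉ms
        cornerless : ∀ {e} → Corner e → e ∉ A △ move t
        cornerless ce with opp ce
        ... | inj₁ refl = ∉△⁻ (∉△⁺ s∈T (v∈move s∈V)) s∉mt
        ... | inj₂ (inj₁ refl) = ∉△⁺ t∈A (v∈move t∈V)
        ... | inj₂ (inj₂ (_ , te)) = ∉△⁻ (∉A ce λ { refl → Graph.irrefl Γ′ refl te })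
                                          (neighbour∉move t∈V (Adj′⇒Adj te))

      -- If opposite corners have no common neighbour in `T`, then `T` contains no third corner,
      -- which is the situation excluded by `no-exterior-detour`.
      shortcut : ∀ {T s t u v} → State T → Corner s → Corner t → s ∈ T → t ∈ T →
                 u ∉ V Γ′ → u ∈ T → Adj Γ s u → v ∉ V Γ′ → v ∈ T → Adj Γ t v →
                 Star (Adj (Γ′ [ T ])) s t
      shortcut {T} {s} {t} S cs ct s∈T t∈T u∉ u∈T su v∉ v∈T tv
        with compareCorners (corner-view cs) (corner-view ct)
      ... | inj₁ refl      = ε
      ... | inj₂ (inj₁ st) = (st , s∈T , t∈T) ◅ ε
      ... | inj₂ (inj₂ opp)
        with any? (λ x → (x ∈? T) ×-dec (Graph.adj? Γ′ s x ×-dec Graph.adj? Γ′ x t))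
      ...   | yes (x , x∈T , sx , xt) = (sx , s∈T , x∈T) ◅ (xt , x∈T , t∈T) ◅ ε
      ...   | no none = ⊥-elim
        (no-exterior-detour S cs ct opp s∈T t∈T only u∉ u∈T su v∉ v∈T tv)
        where
        only : ∀ {x} → Corner x → x ∈ T → x ≡ s ⊎ x ≡ t
        only cx x∈T with opp cx
        ... | inj₁ x≡s              = inj₁ x≡s
        ... | inj₂ (inj₁ x≡t)       = inj₂ x≡t
        ... | inj₂ (inj₂ (sx , tx)) = contradiction (_ , x∈T , sx , sym′ tx) none

      -- Each excursion outside `V Γ′` is replaced by a shortcut between the corners where it leaves
      -- and returns.
      project-walk : ∀ {T x y} → State T → Star (Adj (Γ [ T ])) x y →
                     x ∈ V Γ′ → y ∈ V Γ′ → Star (Adj (Γ′ [ T ])) x y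
      -- `s` and `u` record the corner of departure and the first exterior vertex, both of which
      -- `shortcut` needs on the return.
      project-detour : ∀ {T s u x y} → State T → Corner s → s ∈ T →
                       u ∉ V Γ′ → u ∈ T → Adj Γ s u →
                       Star (Adj (Γ [ T ])) x y → x ∉ V Γ′ → y ∈ V Γ′ →
                       Star (Adj (Γ′ [ T ])) s y

      project-walk S ε x∈ y∈ = ε
      project-walk {x = x} S (_◅_ {j = z} (e , x∈T , z∈T) walk) x∈ y∈ with split e
      ... | inj₁ e′ = (e′ , x∈T , z∈T) ◅ project-walk S walk (proj₂ (∈V Γ′ e′)) y∈
      ... | inj₂ e″ with z ∈? V Γ′
      -- An edge of `Γ″` with both ends in `V Γ′` joins corners, so `Γ′` has it too.
      ...   | yes z∈ = (corner-edge (x∈ , proj₁ (∈V Γ″ e″)) (z∈ , proj₂ (∈V Γ″ e″)) e , x∈T , z∈T)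
                       ◅ project-walk S walk z∈ y∈
      ...   | no  z∉ = project-detour S (x∈ , proj₁ (∈V Γ″ e″)) x∈T z∉ z∈T e walk z∉ y∈

      project-detour S cs s∈T u∉ u∈T su ε x∉ y∈ = contradiction y∈ x∉
      project-detour {x = x} S cs s∈T u∉ u∈T su (_◅_ {j = z} (e , x∈T , z∈T) walk) x∉ y∈
        with z ∈? V Γ′
      ... | no  z∉ = project-detour S cs s∈T u∉ u∈T su walk z∉ y∈
      ... | yes z∈ =
        shortcut S cs (z∈ , proj₂ (∈V Γ″ (edge-at-exterior x∉ e))) s∈T z∈T u∉ u∈T su
                 x∉ x∈T (Graph.sym Γ e)
        ◅◅ project-walk S walk z∈ y∈

      -- Asking for agreement only inside `V Γ′` covers the restricted state and also its complement
      -- in `Γ′`, which is compared with a complement taken in `Γ`.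
      restriction-connected : ∀ {T A} → State T → V Γ′ ∩ A ≡ V Γ′ ∩ T → Connected (Γ′ [ A ])
      restriction-connected {T} {A} S A≡T = nonempty , connected
        where
        T⇒A : ∀ {x} → x ∈ V Γ′ → x ∈ T → x ∈ A
        T⇒A x∈ x∈T = proj₂ (x∈p∩q⁻ _ _ (subst (_ ∈_) (sym A≡T) (x∈p∩q⁺ (x∈ , x∈T))))

        nonempty : Nonempty (V Γ′ ∩ A)
        nonempty = decidable-stable (nonempty? (V Γ′ ∩ A)) λ empty →
          notMissing S λ x∈ x∈T → empty (_ , x∈p∩q⁺ (x∈ , T⇒A x∈ x∈T))

        edge : ∀ {u v} → Adj (Γ′ [ T ]) u v → Adj (Γ′ [ A ]) u v
        edge (e , u∈T , v∈T) = e , T⇒A (proj₁ (∈V Γ′ e)) u∈T , T⇒A (proj₂ (∈V Γ′ e)) v∈T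

        connected : ∀ {x y} → x ∈ V Γ′ ∩ A → y ∈ V Γ′ ∩ A → Star (Adj (Γ′ [ A ])) x y
        connected x∈ y∈ =
          let x∈V , x∈T = x∈p∩q⁻ (V Γ′) T (subst (_ ∈_) A≡T x∈)
              y∈V , y∈T = x∈p∩q⁻ (V Γ′) T (subst (_ ∈_) A≡T y∈)
          in gmap id edge (project-walk S (State-walk S x∈T y∈T) x∈V y∈V)

      -- The restricted legal system

      restrictedMove : Fin n → Subset n
      restrictedMove v = move v ∩ V Γ′

      -- Intersection with `V Γ′` is linear, so a sum of restricted moves is the restriction of the
      -- sum of the full moves.
      lift : ∀ {w′} → Span (λ x → ∃[ v ] (v ∈ V Γ′ × x ≡ restrictedMove v)) w′ →
             ∃[ w ] (Translation w × w′ ≡ w ∩ V Γ′)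
      lift (gen (v , v∈ , refl)) = move v , gen (v , V′⊆V v∈ , refl) , refl
      lift zero                  = ∅ , zero , sym (∩-zeroˡ (V Γ′))
      lift (add s′ t′) with lift s′ | lift t′
      ... | v , s , refl | w , t , refl = v △ w , add s t , sym (∩-distribʳ-△ (V Γ′) v w)

      restrictedSystem : LegalSystem Γ′
      restrictedSystem = record
        { move   = restrictedMove
        ; isMove = λ {v} v∈ → p∩q⊆q (move v) (V Γ′) , x∈p∩q⁺ (v∈move (V′⊆V v∈) , v∈) ,
                     λ u∈ e → neighbour∉move (V′⊆V v∈) (Adj′⇒Adj e) (p∩q⊆p (move v) (V Γ′) u∈)
        ; state  = state ∩ V Γ′
        ; legal  = restrictedLegal
        }
        where
        restrictedLegal : ∀ {w′} → Span (λ x → ∃[ v ] (v ∈ V Γ′ × x ≡ restrictedMove v)) w′ →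
                          IsLegalState Γ′ ((state ∩ V Γ′) △ w′)
        restrictedLegal t′ with lift t′
        ... | w , t , refl =
          subst (IsLegalState Γ′) (∩-distribʳ-△ (V Γ′) state w)
            ( p∩q⊆q T (V Γ′)
            , restriction-connected S-T (⊆-antisym T⇒ T⇐)
            , restriction-connected (State-complement S-T) (⊆-antisym co⇒ co⇐))
          where
          T : Subset n
          T = state △ w
          S-T : State T
          S-T = w , t , inj₁ refl
          T⇒ : V Γ′ ∩ (T ∩ V Γ′) ⊆ V Γ′ ∩ T
          T⇒ x∈ = let x∈V , x∈TV = x∈p∩q⁻ _ _ x∈ in x∈p∩q⁺ (x∈V , p∩q⊆p T (V Γ′) x∈TV)
          T⇐ : V Γ′ ∩ T ⊆ V Γ′ ∩ (T ∩ V Γ′)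
          T⇐ x∈ = let x∈V , x∈T = x∈p∩q⁻ _ _ x∈ in x∈p∩q⁺ (x∈V , x∈p∩q⁺ (x∈T , x∈V))
          co⇒ : V Γ′ ∩ (V Γ′ ─ (T ∩ V Γ′)) ⊆ V Γ′ ∩ (V Γ △ T)
          co⇒ x∈ = let x∈V , x∈─ = x∈p∩q⁻ _ _ x∈ in
            x∈p∩q⁺ (x∈V , ∈△⁺ˡ (V′⊆V x∈V)
              λ x∈T → x∈p─q⇒x∉q (V Γ′) (T ∩ V Γ′) x∈─ (x∈p∩q⁺ (x∈T , x∈V)))
          co⇐ : V Γ′ ∩ (V Γ △ T) ⊆ V Γ′ ∩ (V Γ′ ─ (T ∩ V Γ′))
          co⇐ x∈ = let x∈V , x∈△ = x∈p∩q⁻ _ _ x∈ in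
            x∈p∩q⁺ (x∈V , x∈p∧x∉q⇒x∈p─q x∈V
              λ x∈TV → ∉△⁺ (V′⊆V x∈V) (p∩q⊆p T (V Γ′) x∈TV) x∈△)

  -- Choice between the cone system and the restricted system

  legalSystem : LegalSystem Γ → LegalSystem Γ′
  legalSystem L with coned?
  ... | yes coned = ConedCase.coneSystem coned
  ... | no ¬coned = NotMissing.restrictedSystem λ S misses →
      ¬coned (missing-state⇒coned S λ {x} → misses {x})
    where open Restriction L

theorem3p1 : (n : ℕ) (Γ′ Γ″ C : Graph n) →
    IsInducedFourCycleAmalgam Γ′ Γ″ C →
    LegalSystem (Γ′ ∪ᴳ Γ″) →
    LegalSystem Γ′ × LegalSystem Γ″
theorem3p1 n Γ′ Γ″ C amalgam L =
  Half.legalSystem amalgam ≋-refl L ,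
  Half.legalSystem (amalgam-swap amalgam) (≋-swap {K = Γ′ ∪ᴳ Γ″} {Γ′} {Γ″} ≋-refl) L
  where
  ≋-refl : Γ′ ∪ᴳ Γ″ ≋ Γ′ ∪ᴳ Γ″
  ≋-refl = refl , λ _ _ → mk⇔ id id
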